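{- There exist a finite index subgroup $G$ of $\mathbb{Q}^\times$ and non-zero integers $a,b,c$ such that the equation $ax+by+cz=0$ has no solution with $x,y,z\in G$, but for each place $v$ of $\mathbb{Q}$ the equation has a solution with $x,y,z\in G_{\{v\}}$, where $G_{\{v\}}$ is the completion (i.e. the closure) of $G$ in $\mathbb{Q}_v^\times$.
   Context: Places of $\mathbb{Q}$ are the primes $p$ and the archimedean place $\infty$, with completions $\mathbb{Q}_p$ and $\mathbb{Q}_\infty=\mathbb{R}$. -}

module Defs where

open import Algebra.Bundles using (Group; AbelianGroup; CommutativeRing)
open import Data.Bool.Base using (if_then_else_)
open import Data.Fin.Base using (Fin)
open import Data.Integer.Base as ℤ using (ℤ; +_)
import Data.Integer.Divisibility.Signed as ℤ∣
import Data.Integer.Properties as ℤ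
open import Data.Nat.Base as ℕ using (ℕ; zero; suc)
open import Data.Nat.Divisibility
  using (_∣_; _∣?_; divides; 1∣_; ∣-trans; ∣⇒≤; *-cancelʳ-∣; *-monoˡ-∣)
open import Data.Nat.Primality using (Prime; prime⇒nonZero; prime⇒nonTrivial; euclidsLemma)
import Data.Nat.Properties as ℕ
open import Data.Product using (Σ; ∃; ∃-syntax; ∃!; _×_; _,_)
open import Data.Rational.Base as ℚ
  using (ℚ; mkℚ; 0ℚ; 1ℚ; ½; ↥_; ↧_; ↧ₙ_; _/_; _+_; _*_; _-_; -_; 1/_; _<_; _≤_;
         toℚᵘ; ≢-nonZero; positive; nonNegative)
open import Data.Rational.Properties as ℚ
  hiding (module ≤-Reasoning; 0≤∣p∣; ∣p∣≡0⇒p≡0; ∣p*q∣≡∣p∣*∣q∣; ∣p+q∣≤∣p∣+∣q∣; ∣-p∣≡∣p∣)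
open import Data.Rational.Solver using (module +-*-Solver)
open import Data.Rational.Unnormalised.Base as ℚᵘ using (mkℚᵘ; *≡*; *≤*)
import Data.Rational.Unnormalised.Properties as ℚᵘ
open import Data.Sum.Base using (_⊎_; inj₁; inj₂)
open import Level using (Level; 0ℓ; _⊔_) renaming (suc to ℓsuc)
open import Relation.Binary.Definitions using (tri<; tri≈; tri>)
open import Relation.Binary.PropositionalEquality
  using (_≡_; _≢_; refl; sym; trans; cong; cong₂; subst; module ≡-Reasoning)
open import Relation.Nullary using (¬_; does; yes; no; contradiction)
open import Relation.Unary using (Pred)

private
  variable
    c ℓ p : Level

record Subgroup (Γ : Group c ℓ) (p : Level) : Set (c ⊔ ℓ ⊔ ℓsuc p) where
  open Group Γ
  field
    Member    : Pred Carrier p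
    resp      : ∀ {x y} → x ≈ y → Member x → Member y
    ε-closed  : Member ε
    ∙-closed  : ∀ {x y} → Member x → Member y → Member (x ∙ y)
    ⁻¹-closed : ∀ {x} → Member x → Member (x ⁻¹)

-- There are exactly n left cosets: r lists one representative of each.

HasIndex : {Γ : Group c ℓ} → Subgroup Γ p → ℕ → Set (c ⊔ p)
HasIndex {Γ = Γ} H n =
  Σ (Fin n → Carrier) λ r → ∀ x → ∃! _≡_ λ i → Member (r i ⁻¹ ∙ x)
  where
  open Group Γ
  open Subgroup H

FiniteIndex : {Γ : Group c ℓ} → Subgroup Γ p → Set (c ⊔ p)
FiniteIndex H = ∃ (HasIndex H)

record ℚˣ : Set where
  constructor unit
  field
    value       : ℚ
    .{{nonZero}} : ℚ.NonZero value

open ℚˣ public using (value)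

private
  *-nonZero : ∀ x y → .{{_ : ℚ.NonZero x}} .{{_ : ℚ.NonZero y}} → ℚ.NonZero (x * y)
  *-nonZero x y = ≢-nonZero λ xy≡0 → 0≢y (begin
    0ℚ                ≡⟨ *-zeroʳ (1/ x) ⟨
    1/ x * 0ℚ         ≡⟨ cong (1/ x *_) xy≡0 ⟨
    1/ x * (x * y)    ≡⟨ *-assoc (1/ x) x y ⟨
    (1/ x * x) * y    ≡⟨ cong (_* y) (*-inverseˡ x) ⟩
    1ℚ * y            ≡⟨ *-identityˡ y ⟩
    y                 ∎)
    where
    open ≡-Reasoning
    0≢y : 0ℚ ≢ y
    0≢y 0≡y = go y 0≡y
      where
      go : ∀ y → .{{ℚ.NonZero y}} → 0ℚ ≢ y
      go (mkℚ (ℤ.+[1+ _ ]) _ _) ()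
      go (mkℚ (ℤ.-[1+ _ ]) _ _) ()

ℚˣ-abelianGroup : AbelianGroup 0ℓ 0ℓ
ℚˣ-abelianGroup = record
  { Carrier = ℚˣ
  ; _≈_     = λ x y → value x ≡ value y
  ; _∙_     = λ { (unit x {{nx}}) (unit y {{ny}}) → unit (x * y) {{*-nonZero x y {{nx}} {{ny}}}} }
  ; ε       = unit 1ℚ
  ; _⁻¹     = λ { (unit x {{nx}}) → unit ((1/ x) {{nx}}) {{nonZero⇒1/nonZero x {{nx}}}} }
  ; isAbelianGroup = record
    { isGroup = record
      { isMonoid = record
        { isSemigroup = record
          { isMagma = record
            { isEquivalence = record { refl = refl ; sym = sym ; trans = trans }
            ; ∙-cong = cong₂ _*_
            }
          ; assoc = λ x y z → *-assoc (value x) (value y) (value z)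
          }
        ; identity = (λ x → *-identityˡ (value x)) , (λ x → *-identityʳ (value x))
        }
      ; inverse = (λ { (unit x {{nz}}) → *-inverseˡ x {{nz}} })
                , (λ { (unit x {{nz}}) → *-inverseʳ x {{nz}} })
      ; ⁻¹-cong = λ { {unit x} {unit .x} refl → refl }
      }
    ; comm = λ x y → *-comm (value x) (value y)
    }
  }

ℚˣ-group : Group 0ℓ 0ℓ
ℚˣ-group = AbelianGroup.group ℚˣ-abelianGroup

fromℤ : ℤ → ℚ
fromℤ a = a / 1

record AbsoluteValue : Set where
  field
    ∣_∣           : ℚ → ℚ
    0≤∣p∣         : ∀ x → 0ℚ ≤ ∣ x ∣
    ∣0∣≡0         : ∣ 0ℚ ∣ ≡ 0ℚ
    ∣p∣≡0⇒p≡0     : ∀ x → ∣ x ∣ ≡ 0ℚ → x ≡ 0ℚ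
    ∣p*q∣≡∣p∣*∣q∣ : ∀ x y → ∣ x * y ∣ ≡ ∣ x ∣ * ∣ y ∣
    ∣p+q∣≤∣p∣+∣q∣ : ∀ x y → ∣ x + y ∣ ≤ ∣ x ∣ + ∣ y ∣

private
  square-injective : ∀ x y → 0ℚ ≤ x → 0ℚ ≤ y → x * x ≡ y * y → x ≡ y
  square-injective x y 0≤x 0≤y eq with <-cmp x y
  ... | tri≈ _ x≡y _ = x≡y
  ... | tri< x<y _ _ = contradiction eq (<⇒≢ (lt x y 0≤x x<y))
    where
    lt : ∀ x y → 0ℚ ≤ x → x < y → x * x < y * y
    lt x y 0≤x x<y = ≤-<-trans
      (*-monoˡ-≤-nonNeg x {{nonNegative 0≤x}} (<⇒≤ x<y))
      (*-monoˡ-<-pos y {{positive (≤-<-trans 0≤x x<y)}} x<y)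
  ... | tri> _ _ y<x = contradiction (sym eq) (<⇒≢ (lt y x 0≤y y<x))
    where
    lt : ∀ x y → 0ℚ ≤ x → x < y → x * x < y * y
    lt x y 0≤x x<y = ≤-<-trans
      (*-monoˡ-≤-nonNeg x {{nonNegative 0≤x}} (<⇒≤ x<y))
      (*-monoˡ-<-pos y {{positive (≤-<-trans 0≤x x<y)}} x<y)

  0<½*ε : ∀ {ε} → 0ℚ < ε → 0ℚ < ½ * ε
  0<½*ε {ε} 0<ε = subst (_< ½ * ε) (*-zeroʳ ½) (*-monoʳ-<-pos ½ 0<ε)

  ½ε+½ε≡ε : ∀ ε → ½ * ε + ½ * ε ≡ ε
  ½ε+½ε≡ε ε = trans (sym (*-distribʳ-+ ε ½ ½)) (*-identityˡ ε)

-- The completion of ℚ at an absolute value: Cauchy sequences of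
-- rationals, two of them being equal when their difference tends to 0

module Completion (V : AbsoluteValue) where
  open AbsoluteValue V

  TendsToZero : (ℕ → ℚ) → Set
  TendsToZero s = ∀ ε → 0ℚ < ε → ∃[ N ] (∀ n → N ℕ.≤ n → ∣ s n ∣ < ε)

  IsCauchy : (ℕ → ℚ) → Set
  IsCauchy s = ∀ ε → 0ℚ < ε →
    ∃[ N ] (∀ m n → N ℕ.≤ m → N ℕ.≤ n → ∣ s m - s n ∣ < ε)

  record Completed : Set where
    constructor lim
    field
      seq      : ℕ → ℚ
      isCauchy : IsCauchy seq

  open Completed public

  infix 4 _≈_
  _≈_ : Completed → Completed → Set
  x ≈ y = TendsToZero λ n → seq x n - seq y n

  -- The v-adic distance from x to y is a real number; it is < ε exactly
  -- when the rational distances are eventually bounded by some δ < ε.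

  infix 4 _within_of_
  _within_of_ : Completed → ℚ → Completed → Set
  x within ε of y =
    ∃[ δ ] δ < ε × ∃[ N ] (∀ n → N ℕ.≤ n → ∣ seq x n - seq y n ∣ ≤ δ)

  ∣-p∣≡∣p∣ : ∀ x → ∣ - x ∣ ≡ ∣ x ∣
  ∣-p∣≡∣p∣ x = square-injective _ _ (0≤∣p∣ (- x)) (0≤∣p∣ x) (begin
    ∣ - x ∣ * ∣ - x ∣   ≡⟨ ∣p*q∣≡∣p∣*∣q∣ (- x) (- x) ⟨
    ∣ - x * - x ∣       ≡⟨ cong ∣_∣ (solve 1 (λ a → (:- a) :* (:- a) := a :* a) refl x) ⟩
    ∣ x * x ∣           ≡⟨ ∣p*q∣≡∣p∣*∣q∣ x x ⟩
    ∣ x ∣ * ∣ x ∣       ∎)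
    where
    open ≡-Reasoning
    open +-*-Solver

  sum<ε : ∀ {ε} x y → ∣ x ∣ < ½ * ε → ∣ y ∣ < ½ * ε → ∣ x + y ∣ < ε
  sum<ε {ε} x y x< y< = ≤-<-trans (∣p+q∣≤∣p∣+∣q∣ x y)
    (subst (∣ x ∣ + ∣ y ∣ <_) (½ε+½ε≡ε ε) (+-mono-< x< y<))

  Bounded : (ℕ → ℚ) → ℚ → Set
  Bounded s B = 0ℚ < B × ∃[ N ] (∀ n → N ℕ.≤ n → ∣ s n ∣ < B)

  bounded : ∀ x → ∃ (Bounded (seq x))
  bounded (lim s cauchy) with cauchy 1ℚ (positive⁻¹ 1ℚ)
  ... | N , close = 1ℚ + ∣ s N ∣
      , <-≤-trans (positive⁻¹ 1ℚ)
          (subst (_≤ 1ℚ + ∣ s N ∣) (+-identityʳ 1ℚ) (+-monoʳ-≤ 1ℚ (0≤∣p∣ (s N))))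
      , N , λ n N≤n → ≤-<-trans
          (subst (λ t → ∣ t ∣ ≤ ∣ s n - s N ∣ + ∣ s N ∣)
            (solve 2 (λ a b → a :- b :+ b := a) refl (s n) (s N))
            (∣p+q∣≤∣p∣+∣q∣ (s n - s N) (s N)))
          (+-monoˡ-< ∣ s N ∣ (close n N N≤n ℕ.≤-refl))
    where
    open +-*-Solver

  -- δ is such that |b|, |c| < δ forces |ab + cd| < ε when |a| < B, |d| < C
  module Product {B C ε} (0<B : 0ℚ < B) (0<C : 0ℚ < C) (0<ε : 0ℚ < ε) where
    0<B+C : 0ℚ < B + C
    0<B+C = +-mono-< 0<B 0<C

    instance
      pos  = positive 0<B+C
      posε = positive 0<ε
      nz   = pos⇒nonZero (B + C)

    δ : ℚ
    δ = ε * 1/ (B + C)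

    0<δ : 0ℚ < δ
    0<δ = positive⁻¹ δ {{pos*pos⇒pos ε (1/ (B + C)) {{1/pos⇒pos (B + C)}}}}

    Bδ+δC≡ε : B * δ + δ * C ≡ ε
    Bδ+δC≡ε = begin
      B * δ + δ * C                ≡⟨ solve 3 (λ b c d → b :* d :+ d :* c := d :* (b :+ c)) refl B C δ ⟩
      (ε * 1/ (B + C)) * (B + C)   ≡⟨ *-assoc ε _ _ ⟩
      ε * (1/ (B + C) * (B + C))   ≡⟨ cong (ε *_) (*-inverseˡ (B + C)) ⟩
      ε * 1ℚ                       ≡⟨ *-identityʳ ε ⟩
      ε                            ∎
      where
      open ≡-Reasoning
      open +-*-Solver

    product<ε : ∀ a b c d → ∣ a ∣ < B → ∣ b ∣ < δ → ∣ c ∣ < δ → ∣ d ∣ < C →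
                ∣ a * b + c * d ∣ < ε
    product<ε a b c d a<B b<δ c<δ d<C = begin-strict
      ∣ a * b + c * d ∣              ≤⟨ ∣p+q∣≤∣p∣+∣q∣ (a * b) (c * d) ⟩
      ∣ a * b ∣ + ∣ c * d ∣          ≡⟨ cong₂ _+_ (∣p*q∣≡∣p∣*∣q∣ a b) (∣p*q∣≡∣p∣*∣q∣ c d) ⟩
      ∣ a ∣ * ∣ b ∣ + ∣ c ∣ * ∣ d ∣  ≤⟨ +-mono-≤
                                          (*-monoʳ-≤-nonNeg ∣ b ∣ {{nonNegative (0≤∣p∣ b)}} (<⇒≤ a<B))
                                          (*-monoˡ-≤-nonNeg ∣ c ∣ {{nonNegative (0≤∣p∣ c)}} (<⇒≤ d<C)) ⟩
      B * ∣ b ∣ + ∣ c ∣ * C          <⟨ +-mono-<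
                                          (*-monoʳ-<-pos B {{positive 0<B}} b<δ)
                                          (*-monoˡ-<-pos C {{positive 0<C}} c<δ) ⟩
      B * δ + δ * C                  ≡⟨ Bδ+δC≡ε ⟩
      ε                              ∎
      where
      open ℚ.≤-Reasoning

  ≗⇒≈ : ∀ {x y} → (∀ n → seq x n ≡ seq y n) → x ≈ y
  ≗⇒≈ {x} {y} eq ε 0<ε = 0 , λ n _ → subst (_< ε)
    (sym (trans (cong ∣_∣ (trans (cong (_- seq y n) (eq n)) (+-inverseʳ (seq y n)))) ∣0∣≡0)) 0<ε

  fromℚ : ℚ → Completed
  fromℚ q = lim (λ _ → q) λ ε 0<ε → 0 , λ _ _ _ _ →
    subst (_< ε) (sym (trans (cong ∣_∣ (+-inverseʳ q)) ∣0∣≡0)) 0<ε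

  infixl 6 _⊕_
  infixl 7 _⊗_

  _⊕_ : Completed → Completed → Completed
  x ⊕ y = lim (λ n → seq x n + seq y n) λ ε 0<ε →
    let (M , x<) = isCauchy x (½ * ε) (0<½*ε 0<ε)
        (N , y<) = isCauchy y (½ * ε) (0<½*ε 0<ε)
    in M ℕ.⊔ N , λ m n m≥ n≥ → subst (λ t → ∣ t ∣ < ε)
         (solve 4 (λ a b c d → (a :- b) :+ (c :- d) := (a :+ c) :- (b :+ d)) refl
           (seq x m) (seq x n) (seq y m) (seq y n))
         (sum<ε (seq x m - seq x n) (seq y m - seq y n)
           (x< m n (ℕ.m⊔n≤o⇒m≤o M N m≥) (ℕ.m⊔n≤o⇒m≤o M N n≥))
           (y< m n (ℕ.m⊔n≤o⇒n≤o M N m≥) (ℕ.m⊔n≤o⇒n≤o M N n≥)))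
    where
    open +-*-Solver

  ⊝_ : Completed → Completed
  ⊝ x = lim (λ n → - seq x n) λ ε 0<ε →
    let (N , x<) = isCauchy x ε 0<ε
    in N , λ m n m≥ n≥ → subst (_< ε)
         (trans (sym (∣-p∣≡∣p∣ (seq x m - seq x n)))
           (cong ∣_∣ (solve 2 (λ a b → :- (a :- b) := (:- a) :- (:- b)) refl (seq x m) (seq x n))))
         (x< m n m≥ n≥)
    where
    open +-*-Solver

  _⊗_ : Completed → Completed → Completed
  x ⊗ y = lim (λ n → seq x n * seq y n) λ ε 0<ε →
    let (B , 0<B , M , x<B) = bounded x
        (C , 0<C , N , y<C) = bounded y
        open Product 0<B 0<C 0<ε
        (M′ , x<) = isCauchy x δ 0<δ
        (N′ , y<) = isCauchy y δ 0<δ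
    in (M ℕ.⊔ N) ℕ.⊔ (M′ ℕ.⊔ N′) , λ m n m≥ n≥ → subst (λ t → ∣ t ∣ < ε)
         (solve 4 (λ a b c d → a :* (b :- d) :+ (a :- c) :* d := a :* b :- c :* d) refl
           (seq x m) (seq y m) (seq x n) (seq y n))
         (product<ε (seq x m) (seq y m - seq y n) (seq x m - seq x n) (seq y n)
           (x<B m (ℕ.m⊔n≤o⇒m≤o M N (ℕ.m⊔n≤o⇒m≤o (M ℕ.⊔ N) _ m≥)))
           (y< m n (ℕ.m⊔n≤o⇒n≤o M′ N′ (ℕ.m⊔n≤o⇒n≤o (M ℕ.⊔ N) _ m≥))
                   (ℕ.m⊔n≤o⇒n≤o M′ N′ (ℕ.m⊔n≤o⇒n≤o (M ℕ.⊔ N) _ n≥)))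
           (x< m n (ℕ.m⊔n≤o⇒m≤o M′ N′ (ℕ.m⊔n≤o⇒n≤o (M ℕ.⊔ N) _ m≥))
                   (ℕ.m⊔n≤o⇒m≤o M′ N′ (ℕ.m⊔n≤o⇒n≤o (M ℕ.⊔ N) _ n≥)))
           (y<C n (ℕ.m⊔n≤o⇒n≤o M N (ℕ.m⊔n≤o⇒m≤o (M ℕ.⊔ N) _ n≥))))
    where
    open +-*-Solver

  ≈-sym : ∀ {x y} → x ≈ y → y ≈ x
  ≈-sym {x} {y} x≈y ε 0<ε =
    let (N , lt) = x≈y ε 0<ε
    in N , λ n n≥ → subst (_< ε)
         (trans (sym (∣-p∣≡∣p∣ (seq x n - seq y n)))
           (cong ∣_∣ (solve 2 (λ a b → :- (a :- b) := b :- a) refl (seq x n) (seq y n))))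
         (lt n n≥)
    where
    open +-*-Solver

  ≈-trans : ∀ {x y z} → x ≈ y → y ≈ z → x ≈ z
  ≈-trans {x} {y} {z} x≈y y≈z ε 0<ε =
    let (M , lt₁) = x≈y (½ * ε) (0<½*ε 0<ε)
        (N , lt₂) = y≈z (½ * ε) (0<½*ε 0<ε)
    in M ℕ.⊔ N , λ n n≥ → subst (λ t → ∣ t ∣ < ε)
         (solve 3 (λ a b c → (a :- b) :+ (b :- c) := a :- c) refl (seq x n) (seq y n) (seq z n))
         (sum<ε (seq x n - seq y n) (seq y n - seq z n)
           (lt₁ n (ℕ.m⊔n≤o⇒m≤o M N n≥)) (lt₂ n (ℕ.m⊔n≤o⇒n≤o M N n≥)))
    where
    open +-*-Solver

  ⊕-cong : ∀ {x x′ y y′} → x ≈ x′ → y ≈ y′ → x ⊕ y ≈ x′ ⊕ y′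
  ⊕-cong {x} {x′} {y} {y′} x≈ y≈ ε 0<ε =
    let (M , lt₁) = x≈ (½ * ε) (0<½*ε 0<ε)
        (N , lt₂) = y≈ (½ * ε) (0<½*ε 0<ε)
    in M ℕ.⊔ N , λ n n≥ → subst (λ t → ∣ t ∣ < ε)
         (solve 4 (λ a b c d → (a :- b) :+ (c :- d) := (a :+ c) :- (b :+ d)) refl
           (seq x n) (seq x′ n) (seq y n) (seq y′ n))
         (sum<ε (seq x n - seq x′ n) (seq y n - seq y′ n)
           (lt₁ n (ℕ.m⊔n≤o⇒m≤o M N n≥)) (lt₂ n (ℕ.m⊔n≤o⇒n≤o M N n≥)))
    where
    open +-*-Solver

  ⊝-cong : ∀ {x y} → x ≈ y → ⊝ x ≈ ⊝ y
  ⊝-cong {x} {y} x≈y ε 0<ε =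
    let (N , lt) = x≈y ε 0<ε
    in N , λ n n≥ → subst (_< ε)
         (trans (sym (∣-p∣≡∣p∣ (seq x n - seq y n)))
           (cong ∣_∣ (solve 2 (λ a b → :- (a :- b) := (:- a) :- (:- b)) refl (seq x n) (seq y n))))
         (lt n n≥)
    where
    open +-*-Solver

  ⊗-cong : ∀ {x x′ y y′} → x ≈ x′ → y ≈ y′ → x ⊗ y ≈ x′ ⊗ y′
  ⊗-cong {x} {x′} {y} {y′} x≈ y≈ ε 0<ε =
    let (B , 0<B , M , x<B) = bounded x
        (C , 0<C , N , y<C) = bounded y′
        open Product 0<B 0<C 0<ε
        (M′ , lt₁) = x≈ δ 0<δ
        (N′ , lt₂) = y≈ δ 0<δ
    in (M ℕ.⊔ N) ℕ.⊔ (M′ ℕ.⊔ N′) , λ n n≥ → subst (λ t → ∣ t ∣ < ε)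
         (solve 4 (λ a b c d → a :* (b :- d) :+ (a :- c) :* d := a :* b :- c :* d) refl
           (seq x n) (seq y n) (seq x′ n) (seq y′ n))
         (product<ε (seq x n) (seq y n - seq y′ n) (seq x n - seq x′ n) (seq y′ n)
           (x<B n (ℕ.m⊔n≤o⇒m≤o M N (ℕ.m⊔n≤o⇒m≤o (M ℕ.⊔ N) _ n≥)))
           (lt₂ n (ℕ.m⊔n≤o⇒n≤o M′ N′ (ℕ.m⊔n≤o⇒n≤o (M ℕ.⊔ N) _ n≥)))
           (lt₁ n (ℕ.m⊔n≤o⇒m≤o M′ N′ (ℕ.m⊔n≤o⇒n≤o (M ℕ.⊔ N) _ n≥)))
           (y<C n (ℕ.m⊔n≤o⇒n≤o M N (ℕ.m⊔n≤o⇒m≤o (M ℕ.⊔ N) _ n≥))))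
    where
    open +-*-Solver

  commutativeRing : CommutativeRing 0ℓ 0ℓ
  commutativeRing = record
    { Carrier = Completed
    ; _≈_ = _≈_
    ; _+_ = _⊕_
    ; _*_ = _⊗_
    ; -_  = ⊝_
    ; 0#  = fromℚ 0ℚ
    ; 1#  = fromℚ 1ℚ
    ; isCommutativeRing = record
      { isRing = record
        { +-isAbelianGroup = record
          { isGroup = record
            { isMonoid = record
              { isSemigroup = record
                { isMagma = record
                  { isEquivalence = record
                    { refl  = λ {x} → ≗⇒≈ {x} {x} (λ _ → refl)
                    ; sym   = λ {x} {y} → ≈-sym {x} {y}
                    ; trans = λ {x} {y} {z} → ≈-trans {x} {y} {z}
                    }
                  ; ∙-cong = λ {x} {x′} {y} {y′} → ⊕-cong {x} {x′} {y} {y′}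
                  }
                ; assoc = λ x y z → ≗⇒≈ {(x ⊕ y) ⊕ z} {x ⊕ (y ⊕ z)}
                    λ n → +-assoc (seq x n) (seq y n) (seq z n)
                }
              ; identity = (λ x → ≗⇒≈ {fromℚ 0ℚ ⊕ x} {x} λ n → +-identityˡ (seq x n))
                         , (λ x → ≗⇒≈ {x ⊕ fromℚ 0ℚ} {x} λ n → +-identityʳ (seq x n))
              }
            ; inverse = (λ x → ≗⇒≈ {⊝ x ⊕ x} {fromℚ 0ℚ} λ n → +-inverseˡ (seq x n))
                      , (λ x → ≗⇒≈ {x ⊕ ⊝ x} {fromℚ 0ℚ} λ n → +-inverseʳ (seq x n))
            ; ⁻¹-cong = λ {x} {y} → ⊝-cong {x} {y}
            }
          ; comm = λ x y → ≗⇒≈ {x ⊕ y} {y ⊕ x} λ n → +-comm (seq x n) (seq y n)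
          }
        ; *-cong = λ {x} {x′} {y} {y′} → ⊗-cong {x} {x′} {y} {y′}
        ; *-assoc = λ x y z → ≗⇒≈ {(x ⊗ y) ⊗ z} {x ⊗ (y ⊗ z)}
            λ n → *-assoc (seq x n) (seq y n) (seq z n)
        ; *-identity = (λ x → ≗⇒≈ {fromℚ 1ℚ ⊗ x} {x} λ n → *-identityˡ (seq x n))
                     , (λ x → ≗⇒≈ {x ⊗ fromℚ 1ℚ} {x} λ n → *-identityʳ (seq x n))
        ; distrib = (λ x y z → ≗⇒≈ {x ⊗ (y ⊕ z)} {x ⊗ y ⊕ x ⊗ z}
                      λ n → *-distribˡ-+ (seq x n) (seq y n) (seq z n))
                  , (λ x y z → ≗⇒≈ {(y ⊕ z) ⊗ x} {y ⊗ x ⊕ z ⊗ x}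
                      λ n → *-distribʳ-+ (seq x n) (seq y n) (seq z n))
        }
      ; *-comm = λ x y → ≗⇒≈ {x ⊗ y} {y ⊗ x} λ n → *-comm (seq x n) (seq y n)
      }
    }

largestPower : (p n bound : ℕ) → ℕ
largestPower p n zero    = 0
largestPower p n (suc k) =
  if does (p ℕ.^ suc k ∣? n) then suc k else largestPower p n k

-- The exponent of p in n, for p ≥ 2 and n ≥ 1; it is smaller than n,
-- whence the bound.

ord : ℕ → ℕ → ℕ
ord p n = largestPower p n n

module PAdic (p : ℕ) (pr : Prime p) where
  private instance
    p≢0 : ℕ.NonZero p
    p≢0 = prime⇒nonZero pr

  -- p^(i - j)

  ratio : ℕ → ℕ → ℚ
  ratio i j = (+ (p ℕ.^ i) / (p ℕ.^ j)) {{ℕ.m^n≢0 p j}}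

  -- |n/d|ₚ for d ≠ 0

  size : (n d : ℕ) → ℚ
  size zero      d = 0ℚ
  size n@(suc _) d = ratio (ord p d) (ord p n)

  ∣_∣ₚ : ℚ → ℚ
  ∣ q ∣ₚ = size ℤ.∣ ↥ q ∣ (↧ₙ q)

  1<p : 1 ℕ.< p
  1<p = ℕ.nonTrivial⇒n>1 p {{prime⇒nonTrivial pr}}

  k<p^k : ∀ k → k ℕ.< p ℕ.^ k
  k<p^k zero    = ℕ.≤-refl
  k<p^k (suc k) = ℕ.<-≤-trans (ℕ.s≤s (k<p^k k)) (ℕ.^-monoʳ-< p 1<p (ℕ.n<1+n k))

  largest-∣ : ∀ n k → p ℕ.^ largestPower p n k ∣ n
  largest-∣ n zero = 1∣ n
  largest-∣ n (suc k) with p ℕ.^ suc k ∣? n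
  ... | yes d = d
  ... | no  _ = largest-∣ n k

  largest-max : ∀ n k j → j ℕ.≤ k → p ℕ.^ j ∣ n → j ℕ.≤ largestPower p n k
  largest-max n zero    j j≤k _ = j≤k
  largest-max n (suc k) j j≤k d with p ℕ.^ suc k ∣? n
  ... | yes _ = j≤k
  ... | no ¬d with ℕ.m≤n⇒m<n∨m≡n j≤k
  ...   | inj₁ (ℕ.s≤s j≤k′) = largest-max n k j j≤k′ d
  ...   | inj₂ refl = contradiction d ¬d

  ^-mono-∣ : ∀ {j k} → j ℕ.≤ k → p ℕ.^ j ∣ p ℕ.^ k
  ^-mono-∣ {j} {k} j≤k = divides (p ℕ.^ (k ℕ.∸ j)) (begin
    p ℕ.^ k                         ≡⟨ cong (p ℕ.^_) (ℕ.m∸n+n≡m j≤k) ⟨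
    p ℕ.^ (k ℕ.∸ j ℕ.+ j)           ≡⟨ ℕ.^-distribˡ-+-* p (k ℕ.∸ j) j ⟩
    p ℕ.^ (k ℕ.∸ j) ℕ.* p ℕ.^ j     ∎)
    where
    open ≡-Reasoning

  ord-∣ : ∀ n → p ℕ.^ ord p n ∣ n
  ord-∣ n = largest-∣ n n

  ord-max : ∀ n .{{_ : ℕ.NonZero n}} j → p ℕ.^ j ∣ n → j ℕ.≤ ord p n
  ord-max n j d = largest-max n n j (ℕ.≤-trans (ℕ.<⇒≤ (k<p^k j)) (∣⇒≤ d)) d

  cofactor : ∀ n .{{_ : ℕ.NonZero n}} → ∃[ m ] n ≡ m ℕ.* p ℕ.^ ord p n × ¬ p ∣ m
  cofactor n with ord-∣ n
  ... | divides m eq = m , eq , λ p∣m → ℕ.<-irrefl refl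
    (ord-max n (suc (ord p n)) (subst (p ℕ.^ suc (ord p n) ∣_) (sym eq)
      (*-monoˡ-∣ (p ℕ.^ ord p n) p∣m)))

  ord-* : ∀ a b .{{_ : ℕ.NonZero a}} .{{_ : ℕ.NonZero b}} →
          ord p (a ℕ.* b) ≡ ord p a ℕ.+ ord p b
  ord-* a b with cofactor a | cofactor b
  ... | m , a≡ , p∤m | n , b≡ , p∤n = ℕ.≤-antisym (ℕ.≮⇒≥ upper) lower
    where
    instance ab≢0 = ℕ.m*n≢0 a b
    i = ord p a
    j = ord p b

    ab≡ : a ℕ.* b ≡ (m ℕ.* n) ℕ.* p ℕ.^ (i ℕ.+ j)
    ab≡ = begin
      a ℕ.* b                                   ≡⟨ cong₂ ℕ._*_ a≡ b≡ ⟩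
      (m ℕ.* p ℕ.^ i) ℕ.* (n ℕ.* p ℕ.^ j)       ≡⟨ ℕ.[m*n]*[o*p]≡[m*o]*[n*p] m (p ℕ.^ i) n (p ℕ.^ j) ⟩
      (m ℕ.* n) ℕ.* (p ℕ.^ i ℕ.* p ℕ.^ j)       ≡⟨ cong (m ℕ.* n ℕ.*_) (ℕ.^-distribˡ-+-* p i j) ⟨
      (m ℕ.* n) ℕ.* p ℕ.^ (i ℕ.+ j)             ∎
      where
      open ≡-Reasoning

    lower : i ℕ.+ j ℕ.≤ ord p (a ℕ.* b)
    lower = ord-max (a ℕ.* b) (i ℕ.+ j) (divides (m ℕ.* n) ab≡)

    upper : ¬ (i ℕ.+ j ℕ.< ord p (a ℕ.* b))
    upper lt with euclidsLemma m n pr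
      (*-cancelʳ-∣ (p ℕ.^ (i ℕ.+ j)) {{ℕ.m^n≢0 p (i ℕ.+ j)}} (subst (p ℕ.^ suc (i ℕ.+ j) ∣_) ab≡
        (∣-trans (^-mono-∣ lt) (ord-∣ (a ℕ.* b)))))
    ... | inj₁ p∣m = p∤m p∣m
    ... | inj₂ p∣n = p∤n p∣n

  /-cong-× : ∀ a b c d .{{_ : ℕ.NonZero c}} .{{_ : ℕ.NonZero d}} →
             a ℕ.* d ≡ b ℕ.* c → + a / c ≡ + b / d
  /-cong-× a b (suc c) (suc d) eq = fromℚᵘ-cong {mkℚᵘ (+ a) c} {mkℚᵘ (+ b) d}
    (*≡* (trans (sym (ℤ.pos-* a (suc d))) (trans (cong +_ eq) (ℤ.pos-* b (suc c)))))

  /-* : ∀ a b c d .{{_ : ℕ.NonZero c}} .{{_ : ℕ.NonZero d}} →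
        (+ a / c) * (+ b / d) ≡ (+ (a ℕ.* b) / (c ℕ.* d)) {{ℕ.m*n≢0 c d}}
  /-* a b (suc c) (suc d) = toℚᵘ-injective (begin
    toℚᵘ ((+ a / suc c) * (+ b / suc d))          ≈⟨ toℚᵘ-homo-* (+ a / suc c) (+ b / suc d) ⟩
    toℚᵘ (+ a / suc c) ℚᵘ.* toℚᵘ (+ b / suc d)    ≈⟨ ℚᵘ.*-cong (toℚᵘ-fromℚᵘ (mkℚᵘ (+ a) c)) (toℚᵘ-fromℚᵘ (mkℚᵘ (+ b) d)) ⟩
    mkℚᵘ (+ a) c ℚᵘ.* mkℚᵘ (+ b) d                ≡⟨ cong (λ t → mkℚᵘ t (d ℕ.+ c ℕ.* suc d)) (ℤ.pos-* a b) ⟨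
    mkℚᵘ (+ (a ℕ.* b)) (d ℕ.+ c ℕ.* suc d)        ≈⟨ toℚᵘ-fromℚᵘ (mkℚᵘ (+ (a ℕ.* b)) (d ℕ.+ c ℕ.* suc d)) ⟨
    toℚᵘ (+ (a ℕ.* b) / (suc c ℕ.* suc d))        ∎)
    where
    open import Relation.Binary.Reasoning.Setoid ℚᵘ.≃-setoid

  /-mono : ∀ a c d .{{_ : ℕ.NonZero c}} .{{_ : ℕ.NonZero d}} → d ℕ.≤ c → + a / c ≤ + a / d
  /-mono a (suc c) (suc d) d≤c = toℚᵘ-cancel-≤ (begin
    toℚᵘ (+ a / suc c)   ≃⟨ toℚᵘ-fromℚᵘ (mkℚᵘ (+ a) c) ⟩
    mkℚᵘ (+ a) c         ≤⟨ *≤* (ℤ.*-monoˡ-≤-nonNeg (+ a) (ℤ.+≤+ d≤c)) ⟩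
    mkℚᵘ (+ a) d         ≃⟨ toℚᵘ-fromℚᵘ (mkℚᵘ (+ a) d) ⟨
    toℚᵘ (+ a / suc d)   ∎)
    where
    open ℚᵘ.≤-Reasoning

  ratio-pos : ∀ i j → 0ℚ < ratio i j
  ratio-pos i j = positive⁻¹ (ratio i j)
    {{normalize-pos (p ℕ.^ i) (p ℕ.^ j) {{ℕ.m^n≢0 p j}} {{ℕ.m^n≢0 p i}}}}

  ratio-cong : ∀ i j i′ j′ → i ℕ.+ j′ ≡ i′ ℕ.+ j → ratio i j ≡ ratio i′ j′
  ratio-cong i j i′ j′ eq =
    /-cong-× (p ℕ.^ i) (p ℕ.^ i′) (p ℕ.^ j) (p ℕ.^ j′) {{ℕ.m^n≢0 p j}} {{ℕ.m^n≢0 p j′}} (begin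
      p ℕ.^ i ℕ.* p ℕ.^ j′     ≡⟨ ℕ.^-distribˡ-+-* p i j′ ⟨
      p ℕ.^ (i ℕ.+ j′)         ≡⟨ cong (p ℕ.^_) eq ⟩
      p ℕ.^ (i′ ℕ.+ j)         ≡⟨ ℕ.^-distribˡ-+-* p i′ j ⟩
      p ℕ.^ i′ ℕ.* p ℕ.^ j     ∎)
    where
    open ≡-Reasoning

  ratio-* : ∀ i j i′ j′ → ratio (i ℕ.+ i′) (j ℕ.+ j′) ≡ ratio i j * ratio i′ j′
  ratio-* i j i′ j′ = trans
    (/-cong {{ℕ.m^n≢0 p (j ℕ.+ j′)}} {{ℕ.m*n≢0 (p ℕ.^ j) (p ℕ.^ j′) {{pj}} {{pj′}}}}
      (cong +_ (ℕ.^-distribˡ-+-* p i i′)) (ℕ.^-distribˡ-+-* p j j′))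
    (sym (/-* (p ℕ.^ i) (p ℕ.^ i′) (p ℕ.^ j) (p ℕ.^ j′) {{pj}} {{pj′}}))
    where
    pj  = ℕ.m^n≢0 p j
    pj′ = ℕ.m^n≢0 p j′

  ratio-mono : ∀ i {j j′} → j′ ℕ.≤ j → ratio i j ≤ ratio i j′
  ratio-mono i {j} {j′} j′≤j =
    /-mono (p ℕ.^ i) (p ℕ.^ j) (p ℕ.^ j′) {{ℕ.m^n≢0 p j}} {{ℕ.m^n≢0 p j′}} (ℕ.^-monoʳ-≤ p j′≤j)

  size-nonNeg : ∀ n d → 0ℚ ≤ size n d
  size-nonNeg zero      d = ≤-refl
  size-nonNeg n@(suc _) d = <⇒≤ (ratio-pos (ord p d) (ord p n))

  size-cong : ∀ n d n′ d′ .{{_ : ℕ.NonZero d}} .{{_ : ℕ.NonZero d′}} →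
              n ℕ.* d′ ≡ n′ ℕ.* d → size n d ≡ size n′ d′
  size-cong zero d zero d′ eq = refl
  size-cong zero d n′@(suc _) d′ eq =
    contradiction (sym eq) (ℕ.≢-nonZero⁻¹ (n′ ℕ.* d) {{ℕ.m*n≢0 n′ d}})
  size-cong n@(suc _) d zero d′ eq =
    contradiction eq (ℕ.≢-nonZero⁻¹ (n ℕ.* d′) {{ℕ.m*n≢0 n d′}})
  size-cong n@(suc _) d n′@(suc _) d′ eq =
    ratio-cong (ord p d) (ord p n) (ord p d′) (ord p n′) exponents
    where
    open ≡-Reasoning
    exponents : ord p d ℕ.+ ord p n′ ≡ ord p d′ ℕ.+ ord p n
    exponents = begin
      ord p d ℕ.+ ord p n′    ≡⟨ ℕ.+-comm (ord p d) (ord p n′) ⟩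
      ord p n′ ℕ.+ ord p d    ≡⟨ ord-* n′ d ⟨
      ord p (n′ ℕ.* d)        ≡⟨ cong (ord p) eq ⟨
      ord p (n ℕ.* d′)        ≡⟨ ord-* n d′ ⟩
      ord p n ℕ.+ ord p d′    ≡⟨ ℕ.+-comm (ord p n) (ord p d′) ⟩
      ord p d′ ℕ.+ ord p n    ∎

  size-* : ∀ n d n′ d′ .{{_ : ℕ.NonZero d}} .{{_ : ℕ.NonZero d′}} →
           size (n ℕ.* n′) (d ℕ.* d′) ≡ size n d * size n′ d′
  size-* zero d n′ d′ = sym (*-zeroˡ (size n′ d′))
  size-* n@(suc _) d zero d′ =
    trans (cong (λ t → size t (d ℕ.* d′)) (ℕ.*-zeroʳ n)) (sym (*-zeroʳ (size n d)))
  size-* n@(suc _) d n′@(suc _) d′ = trans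
    (cong₂ ratio (ord-* d d′) (ord-* n n′))
    (ratio-* (ord p d) (ord p n) (ord p d′) (ord p n′))

  size-≤ : ∀ n n′ d .{{_ : ℕ.NonZero n}} → p ℕ.^ ord p n ∣ n′ → size n′ d ≤ size n d
  size-≤ n@(suc _) zero        d _   = size-nonNeg n d
  size-≤ n@(suc _) n′@(suc _) d dvd =
    ratio-mono (ord p d) (ord-max n′ (ord p n) dvd)

  ∣-+ : ∀ {k} a b → k ∣ ℤ.∣ a ∣ → k ∣ ℤ.∣ b ∣ → k ∣ ℤ.∣ a ℤ.+ b ∣
  ∣-+ {k} a b k∣a k∣b = ℤ∣.∣⇒∣ᵤ {+ k} {a ℤ.+ b}
    (ℤ∣.∣m∣n⇒∣m+n {+ k} {a} {b} (ℤ∣.∣ᵤ⇒∣ k∣a) (ℤ∣.∣ᵤ⇒∣ k∣b))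

  size-+ : ∀ a b d → size ℤ.∣ a ℤ.+ b ∣ d ≤ size ℤ.∣ a ∣ d ⊎
                     size ℤ.∣ a ℤ.+ b ∣ d ≤ size ℤ.∣ b ∣ d
  size-+ a b d with ℤ.∣ a ∣ ℕ.≟ 0 | ℤ.∣ b ∣ ℕ.≟ 0
  ... | yes a≡0 | _ = inj₂ (≤-reflexive (cong (λ t → size ℤ.∣ t ∣ d)
        (trans (cong (ℤ._+ b) (ℤ.∣i∣≡0⇒i≡0 {a} a≡0)) (ℤ.+-identityˡ b))))
  ... | no _ | yes b≡0 = inj₁ (≤-reflexive (cong (λ t → size ℤ.∣ t ∣ d)
        (trans (cong (λ t → a ℤ.+ t) (ℤ.∣i∣≡0⇒i≡0 {b} b≡0)) (ℤ.+-identityʳ a))))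
  ... | no a≢0 | no b≢0 with ℕ.≤-total (ord p ℤ.∣ a ∣) (ord p ℤ.∣ b ∣)
  ...   | inj₁ le = inj₁ (size-≤ ℤ.∣ a ∣ ℤ.∣ a ℤ.+ b ∣ d {{ℕ.≢-nonZero a≢0}}
          (∣-+ a b (ord-∣ ℤ.∣ a ∣) (∣-trans (^-mono-∣ le) (ord-∣ ℤ.∣ b ∣))))
  ...   | inj₂ ge = inj₂ (size-≤ ℤ.∣ b ∣ ℤ.∣ a ℤ.+ b ∣ d {{ℕ.≢-nonZero b≢0}}
          (∣-+ a b (∣-trans (^-mono-∣ ge) (ord-∣ ℤ.∣ a ∣)) (ord-∣ ℤ.∣ b ∣)))

  ∣∣ₚ-size : ∀ q a d .{{_ : ℕ.NonZero d}} → ↥ q ℤ.* + d ≡ a ℤ.* ↧ q → ∣ q ∣ₚ ≡ size ℤ.∣ a ∣ d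
  ∣∣ₚ-size q a d eq = size-cong ℤ.∣ ↥ q ∣ (↧ₙ q) ℤ.∣ a ∣ d (begin
    ℤ.∣ ↥ q ∣ ℕ.* d         ≡⟨ ℤ.abs-* (↥ q) (+ d) ⟨
    ℤ.∣ ↥ q ℤ.* + d ∣       ≡⟨ cong ℤ.∣_∣ eq ⟩
    ℤ.∣ a ℤ.* ↧ q ∣         ≡⟨ ℤ.abs-* a (↧ q) ⟩
    ℤ.∣ a ∣ ℕ.* ↧ₙ q        ∎)
    where
    open ≡-Reasoning

  ∣p*q∣ : ∀ x y → ∣ x * y ∣ₚ ≡ ∣ x ∣ₚ * ∣ y ∣ₚ
  ∣p*q∣ x@record{} y@record{} = begin
    ∣ x * y ∣ₚ
      ≡⟨ ∣∣ₚ-size (x * y) (↥ x ℤ.* ↥ y) (↧ₙ x ℕ.* ↧ₙ y) (cross (x * y) (toℚᵘ-homo-* x y)) ⟩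
    size ℤ.∣ ↥ x ℤ.* ↥ y ∣ (↧ₙ x ℕ.* ↧ₙ y)
      ≡⟨ cong (λ t → size t (↧ₙ x ℕ.* ↧ₙ y)) (ℤ.abs-* (↥ x) (↥ y)) ⟩
    size (ℤ.∣ ↥ x ∣ ℕ.* ℤ.∣ ↥ y ∣) (↧ₙ x ℕ.* ↧ₙ y)
      ≡⟨ size-* ℤ.∣ ↥ x ∣ (↧ₙ x) ℤ.∣ ↥ y ∣ (↧ₙ y) ⟩
    ∣ x ∣ₚ * ∣ y ∣ₚ ∎
    where
    open ≡-Reasoning
    cross : ∀ q → toℚᵘ q ℚᵘ.≃ toℚᵘ x ℚᵘ.* toℚᵘ y →
            ↥ q ℤ.* + (↧ₙ x ℕ.* ↧ₙ y) ≡ (↥ x ℤ.* ↥ y) ℤ.* ↧ q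
    cross q@record{} (*≡* e) = e

  ∣p+q∣ : ∀ x y → ∣ x + y ∣ₚ ≤ ∣ x ∣ₚ + ∣ y ∣ₚ
  ∣p+q∣ x@record{} y@record{} = begin
    ∣ x + y ∣ₚ
      ≡⟨ ∣∣ₚ-size (x + y) (a ℤ.+ b) D (cross (x + y) (toℚᵘ-homo-+ x y)) ⟩
    size ℤ.∣ a ℤ.+ b ∣ D
      ≤⟨ max≤sum {t = a} {b} (size-+ a b D) ⟩
    size ℤ.∣ a ∣ D + size ℤ.∣ b ∣ D
      ≡⟨ cong₂ _+_ (∣∣ₚ-size x a D xeq) (∣∣ₚ-size y b D yeq) ⟨
    ∣ x ∣ₚ + ∣ y ∣ₚ ∎
    where
    open ℚ.≤-Reasoning
    a = ↥ x ℤ.* ↧ y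
    b = ↥ y ℤ.* ↧ x
    D = ↧ₙ x ℕ.* ↧ₙ y

    cross : ∀ q → toℚᵘ q ℚᵘ.≃ toℚᵘ x ℚᵘ.+ toℚᵘ y → ↥ q ℤ.* + D ≡ (a ℤ.+ b) ℤ.* ↧ q
    cross q@record{} (*≡* e) = e

    xeq : ↥ x ℤ.* + D ≡ a ℤ.* ↧ x
    xeq = trans (cong (↥ x ℤ.*_) (trans (ℤ.pos-* (↧ₙ x) (↧ₙ y)) (ℤ.*-comm (↧ x) (↧ y))))
                (sym (ℤ.*-assoc (↥ x) (↧ y) (↧ x)))

    yeq : ↥ y ℤ.* + D ≡ b ℤ.* ↧ y
    yeq = trans (cong (↥ y ℤ.*_) (ℤ.pos-* (↧ₙ x) (↧ₙ y)))
                (sym (ℤ.*-assoc (↥ y) (↧ x) (↧ y)))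

    max≤sum : ∀ {s t u} → s ≤ size ℤ.∣ t ∣ D ⊎ s ≤ size ℤ.∣ u ∣ D →
              s ≤ size ℤ.∣ t ∣ D + size ℤ.∣ u ∣ D
    max≤sum {s} {t} {u} (inj₁ le) = ≤-trans le
      (subst (_≤ size ℤ.∣ t ∣ D + size ℤ.∣ u ∣ D) (+-identityʳ (size ℤ.∣ t ∣ D))
        (+-monoʳ-≤ (size ℤ.∣ t ∣ D) (size-nonNeg ℤ.∣ u ∣ D)))
    max≤sum {s} {t} {u} (inj₂ le) = ≤-trans le
      (subst (_≤ size ℤ.∣ t ∣ D + size ℤ.∣ u ∣ D) (+-identityˡ (size ℤ.∣ u ∣ D))
        (+-monoˡ-≤ (size ℤ.∣ u ∣ D) (size-nonNeg ℤ.∣ t ∣ D)))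

  size≡0 : ∀ n d → size n d ≡ 0ℚ → n ≡ 0
  size≡0 zero      d _  = refl
  size≡0 n@(suc _) d eq = contradiction (sym eq) (<⇒≢ (ratio-pos (ord p d) (ord p n)))

  absoluteValue : AbsoluteValue
  absoluteValue = record
    { ∣_∣           = ∣_∣ₚ
    ; 0≤∣p∣         = λ q → size-nonNeg ℤ.∣ ↥ q ∣ (↧ₙ q)
    ; ∣0∣≡0         = refl
    ; ∣p∣≡0⇒p≡0     = λ q eq → ↥p≡0⇒p≡0 q (ℤ.∣i∣≡0⇒i≡0 (size≡0 ℤ.∣ ↥ q ∣ (↧ₙ q) eq))
    ; ∣p*q∣≡∣p∣*∣q∣ = ∣p*q∣
    ; ∣p+q∣≤∣p∣+∣q∣ = ∣p+q∣
    }

archimedean : AbsoluteValue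
archimedean = record
  { ∣_∣           = ℚ.∣_∣
  ; 0≤∣p∣         = ℚ.0≤∣p∣
  ; ∣0∣≡0         = refl
  ; ∣p∣≡0⇒p≡0     = ℚ.∣p∣≡0⇒p≡0
  ; ∣p*q∣≡∣p∣*∣q∣ = ℚ.∣p*q∣≡∣p∣*∣q∣
  ; ∣p+q∣≤∣p∣+∣q∣ = ℚ.∣p+q∣≤∣p∣+∣q∣
  }

data Place : Set where
  finite : (p : ℕ) → Prime p → Place
  ∞      : Place

absoluteValue : Place → AbsoluteValue
absoluteValue (finite p pr) = PAdic.absoluteValue p pr
absoluteValue ∞             = archimedean

module Local (v : Place) where
  open Completion (absoluteValue v) public using (fromℚ; _within_of_)
  open Completion (absoluteValue v) using (commutativeRing)
  open CommutativeRing commutativeRing public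
    using (_≈_; 0#; 1#)
    renaming (Carrier to ℚᵥ; _+_ to _+ᵥ_; _*_ to _*ᵥ_)
  open import Algebra.Definitions _≈_ using (Invertible)

  IsUnit : Pred ℚᵥ 0ℓ
  IsUnit = Invertible 1# _*ᵥ_

  -- Inversion on ℚᵥˣ is continuous, so its topology is the one induced
  -- by the v-adic distance.

  Closure : Subgroup ℚˣ-group p → Pred ℚᵥ p
  Closure G x = IsUnit x ×
    (∀ ε → 0ℚ < ε → ∃[ g ] Member g × x within ε of fromℚ (value g))
    where
    open Subgroup G

SolvableIn : Subgroup ℚˣ-group p → (a b c : ℤ) → Set p
SolvableIn G a b c = ∃[ x ] ∃[ y ] ∃[ z ] Member x × Member y × Member z ×
  fromℤ a * value x + fromℤ b * value y + fromℤ c * value z ≡ 0ℚ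
  where
  open Subgroup G

SolvableInClosure : Subgroup ℚˣ-group p → Place → (a b c : ℤ) → Set p
SolvableInClosure G v a b c =
  ∃[ x ] ∃[ y ] ∃[ z ] Closure G x × Closure G y × Closure G z ×
  fromℚ (fromℤ a) *ᵥ x +ᵥ fromℚ (fromℤ b) *ᵥ y +ᵥ fromℚ (fromℤ c) *ᵥ z ≈ 0#
  where
  open Local v

{-# OPTIONS --safe #-}

-- Take a = b = c = 1 and let G be generated by −3 and the positive rationals
-- that are ≡ 1 mod 3.  If x + y + z = 0 in G, then x, y, z have the same
-- 3-adic valuation k, since after division by (−3)ᵏ for the least k the terms
-- are 0 or 1 mod 3, and neither 1 nor 1 + 1 vanishes mod 3; hence all three
-- have the sign (−1)ᵏ, which is absurd.
-- Locally 1 + 1 + (−2) = 0, and −2 lies in every closure of G: it is the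
-- p-adic limit of −2 + 3pᴺ and the real limit of −3(1 + 6M)/(1 + 9M).

module Submission where

open import Defs
open import Algebra.Bundles using (Group)
open import Data.Fin.Base using (Fin)
open import Data.Fin.Patterns using (0F; 1F; 2F; 3F)
open import Data.Integer.Base as ℤ using (ℤ; +_; -[1+_]; 0ℤ; 1ℤ)
import Data.Integer.Properties as ℤ
import Data.Integer.Solver as ℤ-Solver
open import Data.Nat.Base as ℕ using (ℕ; zero; suc)
open import Data.Nat.Divisibility using (_∣_; divides; _∣?_; ∣⇒≤; n∣m*n)
open import Data.Nat.DivMod using (_divMod_; result)
open import Data.Nat.Induction using (<-rec)
open import Data.Nat.Primality using (prime⇒nonZero)
import Data.Nat.Properties as ℕ
import Data.Nat.Solver as ℕ-Solver
open import Data.Product using (Σ-syntax; ∃-syntax; _×_; _,_)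
open import Data.Rational.Base as ℚ
  using (ℚ; mkℚ; 0ℚ; 1ℚ; ½; ↥_; ↧_; ↧ₙ_; _/_; _+_; _*_; _-_; -_; _<_; _≤_;
         toℚᵘ; *<*; ≢-nonZero)
import Data.Rational.Properties as ℚ
import Data.Rational.Solver as ℚ-Solver
open import Data.Rational.Unnormalised.Base as ℚᵘ using (mkℚᵘ; *≡*)
import Data.Rational.Unnormalised.Properties as ℚᵘ
open import Level using (0ℓ)
open import Relation.Binary.PropositionalEquality
  using (_≡_; _≢_; refl; sym; trans; cong; cong₂; subst; module ≡-Reasoning)
open import Relation.Nullary using (¬_; contradiction)
open import Relation.Nullary.Decidable using (from-no)

-- Integers inside the rationals, and small unit fractions.

/1-* : ∀ a b → fromℤ (a ℤ.* b) ≡ fromℤ a * fromℤ b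
/1-* a b = ℚ.toℚᵘ-injective (begin
  toℚᵘ (fromℤ (a ℤ.* b))              ≈⟨ ℚ.toℚᵘ-fromℚᵘ (mkℚᵘ (a ℤ.* b) 0) ⟩
  mkℚᵘ a 0 ℚᵘ.* mkℚᵘ b 0              ≈⟨ ℚᵘ.*-cong (ℚ.toℚᵘ-fromℚᵘ (mkℚᵘ a 0)) (ℚ.toℚᵘ-fromℚᵘ (mkℚᵘ b 0)) ⟨
  toℚᵘ (fromℤ a) ℚᵘ.* toℚᵘ (fromℤ b)  ≈⟨ ℚ.toℚᵘ-homo-* (fromℤ a) (fromℤ b) ⟨
  toℚᵘ (fromℤ a * fromℤ b)            ∎)
  where open import Relation.Binary.Reasoning.Setoid ℚᵘ.≃-setoid

/1-+ : ∀ a b → fromℤ (a ℤ.+ b) ≡ fromℤ a + fromℤ b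
/1-+ a b = ℚ.toℚᵘ-injective (begin
  toℚᵘ (fromℤ (a ℤ.+ b))              ≈⟨ ℚ.toℚᵘ-fromℚᵘ (mkℚᵘ (a ℤ.+ b) 0) ⟩
  mkℚᵘ (a ℤ.+ b) 0                    ≡⟨ cong (λ t → mkℚᵘ t 0) (cong₂ ℤ._+_ (ℤ.*-identityʳ a) (ℤ.*-identityʳ b)) ⟨
  mkℚᵘ a 0 ℚᵘ.+ mkℚᵘ b 0              ≈⟨ ℚᵘ.+-cong (ℚ.toℚᵘ-fromℚᵘ (mkℚᵘ a 0)) (ℚ.toℚᵘ-fromℚᵘ (mkℚᵘ b 0)) ⟨
  toℚᵘ (fromℤ a) ℚᵘ.+ toℚᵘ (fromℤ b)  ≈⟨ ℚ.toℚᵘ-homo-+ (fromℤ a) (fromℤ b) ⟨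
  toℚᵘ (fromℤ a + fromℤ b)            ∎)
  where open import Relation.Binary.Reasoning.Setoid ℚᵘ.≃-setoid

/1-injective : ∀ {a b} → fromℤ a ≡ fromℤ b → a ≡ b
/1-injective {a} {b} eq with ℚ.fromℚᵘ-injective {mkℚᵘ a 0} {mkℚᵘ b 0} eq
... | *≡* e = trans (sym (ℤ.*-identityʳ a)) (trans e (ℤ.*-identityʳ b))

d*[a/d]≡a : ∀ a d .{{_ : ℕ.NonZero d}} → fromℤ (+ d) * (a / d) ≡ fromℤ a
d*[a/d]≡a a d@(suc k) = ℚ.toℚᵘ-injective (begin
  toℚᵘ (fromℤ (+ d) * (a / d))            ≈⟨ ℚ.toℚᵘ-homo-* (fromℤ (+ d)) (a / d) ⟩
  toℚᵘ (fromℤ (+ d)) ℚᵘ.* toℚᵘ (a / d)    ≈⟨ ℚᵘ.*-cong (ℚ.toℚᵘ-fromℚᵘ (mkℚᵘ (+ d) 0)) (ℚ.toℚᵘ-fromℚᵘ (mkℚᵘ a k)) ⟩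
  mkℚᵘ (+ d) 0 ℚᵘ.* mkℚᵘ a k              ≈⟨ *≡* cross ⟩
  mkℚᵘ a 0                                ≈⟨ ℚ.toℚᵘ-fromℚᵘ (mkℚᵘ a 0) ⟨
  toℚᵘ (fromℤ a)                          ∎)
  where
  open import Relation.Binary.Reasoning.Setoid ℚᵘ.≃-setoid
  cross : + d ℤ.* a ℤ.* 1ℤ ≡ a ℤ.* + (1 ℕ.* d)
  cross = trans (ℤ.*-identityʳ (+ d ℤ.* a))
    (trans (ℤ.*-comm (+ d) a) (cong (λ t → a ℤ.* + t) (sym (ℕ.*-identityˡ d))))

-- A positive `ε` has numerator at least 1, so it is at least the reciprocal of its own denominator.
-- Both approximation arguments take their precision from this denominator.
1/m<ε : ∀ {ε} m .{{_ : ℕ.NonZero m}} → 0ℚ < ε → ↧ₙ ε ℕ.< m → + 1 / m < ε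
1/m<ε {ε@(mkℚ (+ suc n) d _)} m@(suc k) _ d<m = ℚ.toℚᵘ-cancel-< (begin-strict
  toℚᵘ (+ 1 / m)   ≃⟨ ℚ.toℚᵘ-fromℚᵘ (mkℚᵘ (+ 1) k) ⟩
  mkℚᵘ (+ 1) k     <⟨ ℚᵘ.*<* (ℤ.+<+ (ℕ.<-≤-trans
                        (subst (ℕ._< m) (sym (ℕ.*-identityˡ (suc d))) d<m) (ℕ.m≤n*m m (suc n)))) ⟩
  toℚᵘ ε           ∎)
  where open ℚᵘ.≤-Reasoning
1/m<ε {mkℚ (+ zero) _ _} _ (*<* (ℤ.+<+ ()))
1/m<ε {mkℚ -[1+ _ ] _ _} _ (*<* ())

-- The multiplicative set `S` and sums of three of its elements.

-3ℤ : ℤ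
-3ℤ = ℤ.- (+ 3)

-- G is the group of fractions of S.

data S : ℤ → Set where
  base  : ∀ m → S (+ (1 ℕ.+ 3 ℕ.* m))
  shift : ∀ {s} → S s → S (-3ℤ ℤ.* s)

S-resp : ∀ {s t} → s ≡ t → S s → S t
S-resp = subst S

S-* : ∀ {s t} → S s → S t → S (s ℤ.* t)
S-* (base m) (base n) = S-resp
  (trans (cong +_ (solve 2 (λ m n →
      con 1 :+ con 3 :* (m :+ n :+ con 3 :* m :* n) :=
      (con 1 :+ con 3 :* m) :* (con 1 :+ con 3 :* n)) refl m n))
    (ℤ.pos-* (1 ℕ.+ 3 ℕ.* m) (1 ℕ.+ 3 ℕ.* n)))
  (base (m ℕ.+ n ℕ.+ 3 ℕ.* m ℕ.* n))
  where open ℕ-Solver.+-*-Solver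
S-* (base m) (shift {t} y) = S-resp
  (solve 2 (λ s t → con -3ℤ :* (s :* t) := s :* (con -3ℤ :* t)) refl (+ (1 ℕ.+ 3 ℕ.* m)) t)
  (shift (S-* (base m) y))
  where open ℤ-Solver.+-*-Solver
S-* {t = t} (shift {s} x) y = S-resp (sym (ℤ.*-assoc -3ℤ s t)) (shift (S-* x y))

3∤r⇒r≢3k : ∀ r k → ¬ 3 ∣ r → + r ≢ + 3 ℤ.* k
3∤r⇒r≢3k r k 3∤r eq = 3∤r (divides ℤ.∣ k ∣
  (trans (cong ℤ.∣_∣ eq) (trans (ℤ.abs-* (+ 3) k) (ℕ.*-comm 3 ℤ.∣ k ∣))))

base≡1+3m : ∀ m → + (1 ℕ.+ 3 ℕ.* m) ≡ 1ℤ ℤ.+ + 3 ℤ.* + m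
base≡1+3m m = cong (λ t → 1ℤ ℤ.+ t) (ℤ.pos-* 3 m)

module _ where
  open ℤ-Solver.+-*-Solver

  -- Modulo 3 only the first term survives and leaves 1: the sum and 1 differ by 3(s + t - m), so a
  -- zero sum would make 1 a multiple of 3.
  one-base : ∀ m s t → + (1 ℕ.+ 3 ℕ.* m) ℤ.+ -3ℤ ℤ.* s ℤ.+ -3ℤ ℤ.* t ≢ 0ℤ
  one-base m s t eq = 3∤r⇒r≢3k 1 (s ℤ.+ t ℤ.- + m) (from-no (3 ∣? 1)) (begin
    1ℤ
      ≡⟨ solve 3 (λ m s t → con 1ℤ := (con 1ℤ :+ con (+ 3) :* m) :+ con -3ℤ :* s :+ con -3ℤ :* t
           :+ con (+ 3) :* (s :+ t :- m)) refl (+ m) s t ⟩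
    (1ℤ ℤ.+ + 3 ℤ.* + m) ℤ.+ -3ℤ ℤ.* s ℤ.+ -3ℤ ℤ.* t ℤ.+ + 3 ℤ.* (s ℤ.+ t ℤ.- + m)
      ≡⟨ cong (ℤ._+ + 3 ℤ.* (s ℤ.+ t ℤ.- + m)) (trans
           (cong (λ u → u ℤ.+ -3ℤ ℤ.* s ℤ.+ -3ℤ ℤ.* t) (sym (base≡1+3m m))) eq) ⟩
    0ℤ ℤ.+ + 3 ℤ.* (s ℤ.+ t ℤ.- + m)
      ≡⟨ ℤ.+-identityˡ _ ⟩
    + 3 ℤ.* (s ℤ.+ t ℤ.- + m) ∎)
    where open ≡-Reasoning

  -- The same reduction modulo 3, now with residue 1 + 1 = 2.
  two-bases : ∀ m n s → + (1 ℕ.+ 3 ℕ.* m) ℤ.+ + (1 ℕ.+ 3 ℕ.* n) ℤ.+ -3ℤ ℤ.* s ≢ 0ℤ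
  two-bases m n s eq = 3∤r⇒r≢3k 2 (s ℤ.- + m ℤ.- + n) (from-no (3 ∣? 2)) (begin
    + 2
      ≡⟨ solve 3 (λ m n s → con (+ 2) := (con 1ℤ :+ con (+ 3) :* m) :+ (con 1ℤ :+ con (+ 3) :* n)
           :+ con -3ℤ :* s :+ con (+ 3) :* (s :- m :- n)) refl (+ m) (+ n) s ⟩
    (1ℤ ℤ.+ + 3 ℤ.* + m) ℤ.+ (1ℤ ℤ.+ + 3 ℤ.* + n) ℤ.+ -3ℤ ℤ.* s ℤ.+ + 3 ℤ.* (s ℤ.- + m ℤ.- + n)
      ≡⟨ cong (ℤ._+ + 3 ℤ.* (s ℤ.- + m ℤ.- + n)) (trans (cong (ℤ._+ -3ℤ ℤ.* s)
           (cong₂ ℤ._+_ (sym (base≡1+3m m)) (sym (base≡1+3m n)))) eq) ⟩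
    0ℤ ℤ.+ + 3 ℤ.* (s ℤ.- + m ℤ.- + n)
      ≡⟨ ℤ.+-identityˡ _ ⟩
    + 3 ℤ.* (s ℤ.- + m ℤ.- + n) ∎)
    where open ≡-Reasoning

  rotate : ∀ a b c → b ℤ.+ c ℤ.+ a ≡ a ℤ.+ b ℤ.+ c
  rotate = solve 3 (λ a b c → b :+ c :+ a := a :+ b :+ c) refl

  -- Descent on the power of -3. Mixed cases fail modulo 3, after `rotate` has brought the terms
  -- into the order of `one-base` or `two-bases`; three shifts have a common factor -3, which is
  -- cancelled.
  S-sum≢0 : ∀ {a b c} → S a → S b → S c → a ℤ.+ b ℤ.+ c ≢ 0ℤ
  -- Three positive terms: the sum computes to a successor, so it cannot be 0.
  S-sum≢0 (base m) (base n) (base k) ()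
  S-sum≢0 (base m) (base n) (shift {c} _) eq = two-bases m n c eq
  S-sum≢0 (base m) (shift {b} _) (base k) eq =
    two-bases k m b (trans (sym (rotate (+ (1 ℕ.+ 3 ℕ.* k)) (+ (1 ℕ.+ 3 ℕ.* m)) (-3ℤ ℤ.* b))) eq)
  S-sum≢0 (shift {a} _) (base n) (base k) eq =
    two-bases n k a (trans (rotate (-3ℤ ℤ.* a) (+ (1 ℕ.+ 3 ℕ.* n)) (+ (1 ℕ.+ 3 ℕ.* k))) eq)
  S-sum≢0 (base m) (shift {b} _) (shift {c} _) eq = one-base m b c eq
  S-sum≢0 (shift {a} _) (base n) (shift {c} _) eq =
    one-base n c a (trans (rotate (-3ℤ ℤ.* a) (+ (1 ℕ.+ 3 ℕ.* n)) (-3ℤ ℤ.* c)) eq)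
  S-sum≢0 (shift {a} _) (shift {b} _) (base k) eq =
    one-base k a b (trans (sym (rotate (+ (1 ℕ.+ 3 ℕ.* k)) (-3ℤ ℤ.* a) (-3ℤ ℤ.* b))) eq)
  S-sum≢0 (shift {a} x) (shift {b} y) (shift {c} z) eq =
    S-sum≢0 x y z (ℤ.*-cancelˡ-≡ -3ℤ (a ℤ.+ b ℤ.+ c) 0ℤ (trans
      (solve 3 (λ a b c → con -3ℤ :* (a :+ b :+ c) := con -3ℤ :* a :+ con -3ℤ :* b :+ con -3ℤ :* c)
        refl a b c) eq))

-- If `s` were 0, then s + s + s = 0 would contradict `S-sum≢0`.
S⇒≢0 : ∀ {s} → S s → s ≢ 0ℤ
S⇒≢0 x refl = S-sum≢0 x x x refl

-- The group `G` and sums of three of its elements.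

infix 4 _∈G

-- Cleared of denominators, so that the closure properties become identities between products.
_∈G : ℚ → Set
q ∈G = ∃[ s ] ∃[ t ] S s × S t × fromℤ t * q ≡ fromℤ s

S⊆G : ∀ {s} → S s → fromℤ s ∈G
S⊆G {s} x = s , 1ℤ , x , base 0 , ℚ.*-identityˡ (fromℤ s)

∈G⇒nonZero : ∀ {q} → q ∈G → ℚ.NonZero q
∈G⇒nonZero {q} (s , t , x , _ , eq) = ≢-nonZero {q} λ { refl →
  S⇒≢0 x (/1-injective (trans (sym eq) (ℚ.*-zeroʳ (fromℤ t)))) }

G-* : ∀ {x y} → x ∈G → y ∈G → x * y ∈G
G-* {x} {y} (s , t , xs , xt , ex) (u , v , yu , yv , ey) =
  s ℤ.* u , t ℤ.* v , S-* xs yu , S-* xt yv , (begin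
    fromℤ (t ℤ.* v) * (x * y)          ≡⟨ cong (_* (x * y)) (/1-* t v) ⟩
    (fromℤ t * fromℤ v) * (x * y)      ≡⟨ solve 4 (λ t v x y → (t :* v) :* (x :* y) := (t :* x) :* (v :* y))
                                            refl (fromℤ t) (fromℤ v) x y ⟩
    (fromℤ t * x) * (fromℤ v * y)      ≡⟨ cong₂ _*_ ex ey ⟩
    fromℤ s * fromℤ u                  ≡⟨ /1-* s u ⟨
    fromℤ (s ℤ.* u)                    ∎)
  where
  open ≡-Reasoning
  open ℚ-Solver.+-*-Solver

G-inverse : ∀ {x y} → x * y ≡ 1ℚ → x ∈G → y ∈G
G-inverse {x} {y} xy≡1 (s , t , xs , xt , ex) = t , s , xt , xs , (begin
  fromℤ s * y          ≡⟨ cong (_* y) ex ⟨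
  fromℤ t * x * y      ≡⟨ ℚ.*-assoc (fromℤ t) x y ⟩
  fromℤ t * (x * y)    ≡⟨ cong (fromℤ t *_) xy≡1 ⟩
  fromℤ t * 1ℚ         ≡⟨ ℚ.*-identityʳ (fromℤ t) ⟩
  fromℤ t              ∎)
  where open ≡-Reasoning

-- Multiplying by the common denominator t₁t₂t₃ turns each term into a product of elements of `S`,
-- which reduces the claim to `S-sum≢0`.
G-sum≢0 : ∀ {x y z} → x ∈G → y ∈G → z ∈G → x + y + z ≢ 0ℚ
G-sum≢0 {x} {y} {z} (s₁ , t₁ , xs , xt , ex) (s₂ , t₂ , ys , yt , ey) (s₃ , t₃ , zs , zt , ez) eq =
  S-sum≢0 (S-* xs (S-* yt zt)) (S-* ys (S-* xt zt)) (S-* zs (S-* xt yt)) (/1-injective (begin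
    fromℤ (S₁ ℤ.+ S₂ ℤ.+ S₃)
      ≡⟨ trans (/1-+ (S₁ ℤ.+ S₂) S₃) (cong₂ _+_ (trans (/1-+ S₁ S₂) (cong₂ _+_
           (cleared s₁ t₂ t₃ ex) (cleared s₂ t₁ t₃ ey))) (cleared s₃ t₁ t₂ ez)) ⟩
    (T₁ * x) * (T₂ * T₃) + (T₂ * y) * (T₁ * T₃) + (T₃ * z) * (T₁ * T₂)
      ≡⟨ solve 6 (λ x y z t₁ t₂ t₃ →
           (t₁ :* x) :* (t₂ :* t₃) :+ (t₂ :* y) :* (t₁ :* t₃) :+ (t₃ :* z) :* (t₁ :* t₂) :=
           t₁ :* t₂ :* t₃ :* (x :+ y :+ z)) refl x y z T₁ T₂ T₃ ⟩
    T₁ * T₂ * T₃ * (x + y + z)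
      ≡⟨ cong (T₁ * T₂ * T₃ *_) eq ⟩
    T₁ * T₂ * T₃ * 0ℚ
      ≡⟨ ℚ.*-zeroʳ (T₁ * T₂ * T₃) ⟩
    0ℚ ∎))
  where
  open ≡-Reasoning
  open ℚ-Solver.+-*-Solver
  S₁ = s₁ ℤ.* (t₂ ℤ.* t₃)
  S₂ = s₂ ℤ.* (t₁ ℤ.* t₃)
  S₃ = s₃ ℤ.* (t₁ ℤ.* t₂)
  T₁ = fromℤ t₁
  T₂ = fromℤ t₂
  T₃ = fromℤ t₃
  cleared : ∀ s t u {q} → q ≡ fromℤ s → fromℤ (s ℤ.* (t ℤ.* u)) ≡ q * (fromℤ t * fromℤ u)
  cleared s t u refl = trans (/1-* s (t ℤ.* u)) (cong (fromℤ s *_) (/1-* t u))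

G : Subgroup ℚˣ-group 0ℓ
G = record
  { Member    = λ x → value x ∈G
  ; resp      = subst _∈G
  ; ε-closed  = S⊆G (base 0)
  ; ∙-closed  = λ { {unit _} {unit _} → G-* }
  ; ⁻¹-closed = λ { {unit x {{nz}}} → G-inverse (ℚ.*-inverseʳ x {{nz}}) }
  }

-- Every non-zero rational lies in one of four cosets of `G`.

-- The last non-zero ternary digit: the residue modulo 3 that is left once all factors 3 are
-- removed.
data Digit : ℕ → Set where
  one    : ∀ m → Digit (1 ℕ.+ 3 ℕ.* m)
  two    : ∀ m → Digit (2 ℕ.+ 3 ℕ.* m)
  thrice : ∀ {n} → Digit n → Digit (3 ℕ.* n)

digit : ∀ n .{{_ : ℕ.NonZero n}} → Digit n
digit n = <-rec (λ n → .{{ℕ.NonZero n}} → Digit n) step n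
  where
  step : ∀ n → (∀ {k} → k ℕ.< n → .{{ℕ.NonZero k}} → Digit k) → .{{ℕ.NonZero n}} → Digit n
  step n rec with n divMod 3
  ... | result q 1F eq = subst Digit (sym (trans eq (cong suc (ℕ.*-comm q 3)))) (one q)
  ... | result q 2F eq = subst Digit (sym (trans eq (cong (2 ℕ.+_) (ℕ.*-comm q 3)))) (two q)
  ... | result zero 0F refl = contradiction refl (ℕ.≢-nonZero⁻¹ n)
  ... | result q@(suc _) 0F refl = subst Digit (ℕ.*-comm 3 q)
    (thrice (rec (ℕ.m<m*n q 3 (ℕ.s≤s (ℕ.s≤s ℕ.z≤n)))))

-- Squaring sends both non-zero residues modulo 3 to 1, and 9 = (-3)². Squares of denominators thus
-- lie in `S`, which lets `cosetℚ` pass from a fraction to an integer.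
S-square : ∀ {n} → Digit n → S (+ n ℤ.* + n)
S-square (one m) = S-* (base m) (base m)
S-square (two m) = S-resp
  (trans (cong +_ (solve 1 (λ m →
      con 1 :+ con 3 :* (con 1 :+ con 4 :* m :+ con 3 :* m :* m) :=
      (con 2 :+ con 3 :* m) :* (con 2 :+ con 3 :* m)) refl m))
    (ℤ.pos-* (2 ℕ.+ 3 ℕ.* m) (2 ℕ.+ 3 ℕ.* m)))
  (base (1 ℕ.+ 4 ℕ.* m ℕ.+ 3 ℕ.* m ℕ.* m))
  where open ℕ-Solver.+-*-Solver
S-square (thrice {n} d) = S-resp
  (trans (solve 1 (λ n → con -3ℤ :* (con -3ℤ :* (n :* n)) := (con (+ 3) :* n) :* (con (+ 3) :* n))
      refl (+ n))
    (cong₂ ℤ._*_ (sym (ℤ.pos-* 3 n)) (sym (ℤ.pos-* 3 n))))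
  (shift (shift (S-square d)))
  where open ℤ-Solver.+-*-Solver

-- Once a power of -3 is removed, a coset of `G` is given by a sign and by the residue modulo 3 of
-- the absolute value. Halves are used because the coset condition involves the inverses of the
-- representatives, which are then the integers `rep⁻¹`.
rep : Fin 4 → ℚˣ
rep 0F = unit 1ℚ
rep 1F = unit (- 1ℚ)
rep 2F = unit ½
rep 3F = unit (- ½)

rep⁻¹ : Fin 4 → ℤ
rep⁻¹ 0F = + 1
rep⁻¹ 1F = -[1+ 0 ]
rep⁻¹ 2F = + 2
rep⁻¹ 3F = -[1+ 1 ]

-- Needed because `thrice` multiplies by 3 but `shift` by -3: each factor 3 changes the sign of the
-- representative.
opposite : ∀ i → ∃[ j ] rep⁻¹ j ≡ ℤ.- rep⁻¹ i
opposite 0F = 1F , refl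
opposite 1F = 0F , refl
opposite 2F = 3F , refl
opposite 3F = 2F , refl

cosetℕ : ∀ {n} → Digit n → ∃[ i ] S (rep⁻¹ i ℤ.* + n)
cosetℕ (one m) = 0F , S-resp (sym (ℤ.*-identityˡ _)) (base m)
-- Doubling the residue 2 gives 4, which is 1 modulo 3.
cosetℕ (two m) = 2F , S-resp
  (trans (cong +_ (solve 1 (λ m → con 1 :+ con 3 :* (con 1 :+ con 2 :* m) :=
      con 2 :* (con 2 :+ con 3 :* m)) refl m))
    (ℤ.pos-* 2 (2 ℕ.+ 3 ℕ.* m)))
  (base (1 ℕ.+ 2 ℕ.* m))
  where open ℕ-Solver.+-*-Solver
cosetℕ (thrice {n} d) with cosetℕ d
... | i , x with opposite i
...   | j , eq = j , S-resp
  (trans (solve 2 (λ r n → con -3ℤ :* (r :* n) := (:- r) :* (con (+ 3) :* n)) refl (rep⁻¹ i) (+ n))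
    (cong₂ ℤ._*_ (sym eq) (sym (ℤ.pos-* 3 n))))
  (shift x)
  where open ℤ-Solver.+-*-Solver

cosetℤ : ∀ n .{{_ : ℤ.NonZero n}} → ∃[ i ] S (rep⁻¹ i ℤ.* n)
cosetℤ (+ n) = cosetℕ (digit n)
cosetℤ -[1+ n ] with cosetℕ (digit (suc n))
... | i , x with opposite i
...   | j , eq = j , S-resp
  (trans (solve 2 (λ r n → r :* n := (:- r) :* (:- n)) refl (rep⁻¹ i) (+ suc n))
    (cong (ℤ._* -[1+ n ]) (sym eq)))
  x
  where open ℤ-Solver.+-*-Solver

cosetℚ : ∀ q .{{_ : ℚ.NonZero q}} → ∃[ i ] fromℤ (rep⁻¹ i) * q ∈G
-- With d the denominator of `q`, the integer q·d² is numerator times denominator. It lies in the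
-- same coset as `q`, since d² is in `S`.
cosetℚ q@record{} with cosetℤ (↥ q ℤ.* ↧ q) {{ℤ.i*j≢0 (↥ q) (↧ q)}}
... | i , x = i , rep⁻¹ i ℤ.* (↥ q ℤ.* ↧ q) , ↧ q ℤ.* ↧ q , x , S-square (digit (↧ₙ q)) , (begin
  fromℤ (↧ q ℤ.* ↧ q) * (r * q)      ≡⟨ cong (_* (r * q)) (/1-* (↧ q) (↧ q)) ⟩
  (d * d) * (r * q)                  ≡⟨ solve 3 (λ d r q → (d :* d) :* (r :* q) := r :* ((d :* q) :* d)) refl d r q ⟩
  r * ((d * q) * d)                  ≡⟨ cong (λ n → r * (n * d)) d*q ⟩
  r * (fromℤ (↥ q) * d)              ≡⟨ cong (r *_) (/1-* (↥ q) (↧ q)) ⟨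
  r * fromℤ (↥ q ℤ.* ↧ q)            ≡⟨ /1-* (rep⁻¹ i) (↥ q ℤ.* ↧ q) ⟨
  fromℤ (rep⁻¹ i ℤ.* (↥ q ℤ.* ↧ q))  ∎)
  where
  open ≡-Reasoning
  open ℚ-Solver.+-*-Solver
  r = fromℤ (rep⁻¹ i)
  d = fromℤ (↧ q)
  d*q : d * q ≡ fromℤ (↥ q)
  d*q = trans (cong (d *_) (sym (ℚ.↥p/↧p≡p q))) (d*[a/d]≡a (↥ q) (↧ₙ q))

-- The four cosets are distinct.

S-1 : S 1ℤ
S-1 = base 0

S-4 : S (+ 4)
S-4 = base 1

S-[-3] : S -3ℤ
S-[-3] = shift (base 0)

-- The impossibility of x + y + z = 0 in `G` also separates cosets: multiplied by `x`, a relation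
-- among representatives with coefficients from `S` would be such a sum. The indices may repeat, so
-- a relation between two representatives suffices.
no-relation : ∀ i j k {α β γ} x → S α → S β → S γ →
              let u = fromℤ (rep⁻¹ i); v = fromℤ (rep⁻¹ j); w = fromℤ (rep⁻¹ k) in
              fromℤ α * u + fromℤ β * v + fromℤ γ * w ≡ 0ℚ →
              u * x ∈G → v * x ∈G → ¬ (w * x ∈G)
no-relation i j k {α} {β} {γ} x a b c eq ux vx wx =
  G-sum≢0 (G-* (S⊆G a) ux) (G-* (S⊆G b) vx) (G-* (S⊆G c) wx) (begin
    fromℤ α * (u * x) + fromℤ β * (v * x) + fromℤ γ * (w * x)
      ≡⟨ solve 7 (λ α β γ u v w x → α :* (u :* x) :+ β :* (v :* x) :+ γ :* (w :* x) :=
           (α :* u :+ β :* v :+ γ :* w) :* x) refl (fromℤ α) (fromℤ β) (fromℤ γ) u v w x ⟩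
    (fromℤ α * u + fromℤ β * v + fromℤ γ * w) * x
      ≡⟨ cong (_* x) eq ⟩
    0ℚ * x
      ≡⟨ ℚ.*-zeroˡ x ⟩
    0ℚ ∎)
  where
  open ≡-Reasoning
  open ℚ-Solver.+-*-Solver
  u = fromℤ (rep⁻¹ i)
  v = fromℤ (rep⁻¹ j)
  w = fromℤ (rep⁻¹ k)

-- y, −y: y + 4(−y) − 3(−y) = 0;  y, 2y: 4y + 2y − 3(2y) = 0;  y, −2y: y + y + (−2y) = 0.
rep-injective : ∀ i j x → fromℤ (rep⁻¹ i) * x ∈G → fromℤ (rep⁻¹ j) * x ∈G → i ≡ j
rep-injective 0F 0F x p q = refl
rep-injective 1F 1F x p q = refl
rep-injective 2F 2F x p q = refl
rep-injective 3F 3F x p q = refl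
rep-injective 0F 1F x p q = contradiction q (no-relation 0F 1F 1F x S-1 S-4 S-[-3] refl p q)
rep-injective 1F 0F x p q = contradiction q (no-relation 1F 0F 0F x S-1 S-4 S-[-3] refl p q)
rep-injective 2F 3F x p q = contradiction q (no-relation 2F 3F 3F x S-1 S-4 S-[-3] refl p q)
rep-injective 3F 2F x p q = contradiction q (no-relation 3F 2F 2F x S-1 S-4 S-[-3] refl p q)
rep-injective 0F 2F x p q = contradiction q (no-relation 0F 2F 2F x S-4 S-1 S-[-3] refl p q)
rep-injective 2F 0F x p q = contradiction p (no-relation 0F 2F 2F x S-4 S-1 S-[-3] refl q p)
rep-injective 1F 3F x p q = contradiction q (no-relation 1F 3F 3F x S-4 S-1 S-[-3] refl p q)
rep-injective 3F 1F x p q = contradiction p (no-relation 1F 3F 3F x S-4 S-1 S-[-3] refl q p)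
rep-injective 0F 3F x p q = contradiction q (no-relation 0F 0F 3F x S-1 S-1 S-1 refl p p)
rep-injective 3F 0F x p q = contradiction p (no-relation 0F 0F 3F x S-1 S-1 S-1 refl q q)
rep-injective 1F 2F x p q = contradiction q (no-relation 1F 1F 2F x S-1 S-1 S-1 refl p p)
rep-injective 2F 1F x p q = contradiction p (no-relation 1F 1F 2F x S-1 S-1 S-1 refl q q)

open Group ℚˣ-group using (_∙_; _⁻¹)

rep⁻¹∙ : ∀ i x → value (rep i ⁻¹ ∙ x) ≡ fromℤ (rep⁻¹ i) * value x
rep⁻¹∙ 0F (unit _) = refl
rep⁻¹∙ 1F (unit _) = refl
rep⁻¹∙ 2F (unit _) = refl
rep⁻¹∙ 3F (unit _) = refl

G-finiteIndex : FiniteIndex G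
G-finiteIndex = 4 , rep , λ { x@(unit q) →
  let (i , m) = cosetℚ q
  in i , subst _∈G (sym (rep⁻¹∙ i x)) m
       , λ {j} n → rep-injective i j q m (subst _∈G (rep⁻¹∙ j x) n) }

-- Global unsolvability, and approximation of -2 at every place.

unsolvable : ¬ SolvableIn G 1ℤ 1ℤ 1ℤ
unsolvable (x , y , z , xG , yG , zG , eq) = G-sum≢0 xG yG zG (trans
  (sym (cong₂ _+_ (cong₂ _+_ (ℚ.*-identityˡ (value x)) (ℚ.*-identityˡ (value y)))
    (ℚ.*-identityˡ (value z)))) eq)

-2ℚ : ℚ
-2ℚ = fromℤ (ℤ.- (+ 2))

Approximable : AbsoluteValue → ℚ → Set
Approximable V q = ∀ ε → 0ℚ < ε → ∃[ g ] g ∈G × ∣ q - g ∣ < ε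
  where open AbsoluteValue V

approximable⇒closure : ∀ v {q r} → r * q ≡ 1ℚ → Approximable (absoluteValue v) q →
                       Local.Closure v G (Local.fromℚ v q)
approximable⇒closure v {q} {r} rq≡1 approx =
  ( fromℚ r
  , ≗⇒≈ {fromℚ r ⊗ fromℚ q} {fromℚ 1ℚ} (λ _ → rq≡1)
  , ≗⇒≈ {fromℚ q ⊗ fromℚ r} {fromℚ 1ℚ} (λ _ → trans (ℚ.*-comm q r) rq≡1))
  , λ ε 0<ε →
    let (g , g∈G , close) = approx ε 0<ε
    -- Both sequences are constant, so their rational distance itself serves as the bound δ < ε,
    -- valid from index 0.
    in unit g {{∈G⇒nonZero g∈G}} , g∈G , _ , close , 0 , λ _ _ → ℚ.≤-refl
  where open Completion (absoluteValue v)

∈G⇒approximable : ∀ V {q} → q ∈G → Approximable V q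
∈G⇒approximable V {q} q∈G ε 0<ε = q , q∈G ,
  subst (_< ε) (sym (trans (cong ∣_∣ (ℚ.+-inverseʳ q)) ∣0∣≡0)) 0<ε
  where open AbsoluteValue V

-2-approximable-∞ : Approximable archimedean -2ℚ
-- With e = 1/(1 + 9M), -2 - e = -3(1 + 6M)/(1 + 9M). The single factor -3 supplies the negative
-- sign, and taking `M` to be the denominator of `ε` makes e < ε.
-2-approximable-∞ ε 0<ε = -2ℚ - e
  , (-3ℤ ℤ.* + (1 ℕ.+ 3 ℕ.* (2 ℕ.* M)) , + t , shift (base (2 ℕ.* M)) , base (3 ℕ.* M) , member)
  , subst (_< ε) (sym abs) (1/m<ε t 0<ε M<t)
  where
  M = ↧ₙ ε
  t = 1 ℕ.+ 3 ℕ.* (3 ℕ.* M)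
  e = + 1 / t

  M<t : M ℕ.< t
  M<t = ℕ.s≤s (ℕ.≤-trans (ℕ.m≤n*m M 3) (ℕ.m≤n*m (3 ℕ.* M) 3))

  abs : ℚ.∣ -2ℚ - (-2ℚ - e) ∣ ≡ e
  abs = trans
    (cong ℚ.∣_∣ (solve 1
      (λ e → con -2ℚ :- (con -2ℚ :- e) := e) refl e))
    (ℚ.0≤p⇒∣p∣≡p (ℚ.nonNegative⁻¹ e {{ℚ.normalize-nonNeg 1 t}}))
    where open ℚ-Solver.+-*-Solver

  member : fromℤ (+ t) * (-2ℚ - e) ≡ fromℤ (-3ℤ ℤ.* + (1 ℕ.+ 3 ℕ.* (2 ℕ.* M)))
  member = begin
    fromℤ (+ t) * (-2ℚ - e)
      ≡⟨ solve 2 (λ t e → t :* (con -2ℚ :- e) := con -2ℚ :* t :+ con (- 1ℚ) :* (t :* e)) refl (fromℤ (+ t)) e ⟩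
    -2ℚ * fromℤ (+ t) + - 1ℚ * (fromℤ (+ t) * e)
      ≡⟨ cong (λ u → -2ℚ * fromℤ (+ t) + - 1ℚ * u) (d*[a/d]≡a (+ 1) t) ⟩
    -2ℚ * fromℤ (+ t) + - 1ℚ
      ≡⟨ cong (_+ - 1ℚ) (/1-* (ℤ.- (+ 2)) (+ t)) ⟨
    fromℤ (ℤ.- (+ 2) ℤ.* + t) + - 1ℚ
      ≡⟨ /1-+ (ℤ.- (+ 2) ℤ.* + t) (ℤ.- 1ℤ) ⟨
    fromℤ (ℤ.- (+ 2) ℤ.* + t ℤ.+ ℤ.- 1ℤ)
      ≡⟨ cong fromℤ integral ⟩
    fromℤ (-3ℤ ℤ.* + (1 ℕ.+ 3 ℕ.* (2 ℕ.* M))) ∎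
    where
    open ≡-Reasoning
    open ℚ-Solver.+-*-Solver
    integral : ℤ.- (+ 2) ℤ.* + t ℤ.+ ℤ.- 1ℤ ≡ -3ℤ ℤ.* + (1 ℕ.+ 3 ℕ.* (2 ℕ.* M))
    integral = begin
      ℤ.- (+ 2) ℤ.* + t ℤ.+ ℤ.- 1ℤ
        ≡⟨ cong (λ u → ℤ.- (+ 2) ℤ.* u ℤ.+ ℤ.- 1ℤ) (base≡1+3m (3 ℕ.* M)) ⟩
      ℤ.- (+ 2) ℤ.* (1ℤ ℤ.+ + 3 ℤ.* + (3 ℕ.* M)) ℤ.+ ℤ.- 1ℤ
        ≡⟨ cong (λ u → ℤ.- (+ 2) ℤ.* (1ℤ ℤ.+ + 3 ℤ.* u) ℤ.+ ℤ.- 1ℤ) (ℤ.pos-* 3 M) ⟩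
      ℤ.- (+ 2) ℤ.* (1ℤ ℤ.+ + 3 ℤ.* (+ 3 ℤ.* + M)) ℤ.+ ℤ.- 1ℤ
        ≡⟨ ℤS.solve 1 (λ m →
             ℤS.con (ℤ.- (+ 2)) ℤS.:* (ℤS.con 1ℤ ℤS.:+ ℤS.con (+ 3) ℤS.:* (ℤS.con (+ 3) ℤS.:* m)) ℤS.:+ ℤS.con (ℤ.- 1ℤ) ℤS.:=
             ℤS.con -3ℤ ℤS.:* (ℤS.con 1ℤ ℤS.:+ ℤS.con (+ 3) ℤS.:* (ℤS.con (+ 2) ℤS.:* m))) refl (+ M) ⟩
      -3ℤ ℤ.* (1ℤ ℤ.+ + 3 ℤ.* (+ 2 ℤ.* + M))
        ≡⟨ cong (λ u → -3ℤ ℤ.* (1ℤ ℤ.+ + 3 ℤ.* u)) (ℤ.pos-* 2 M) ⟨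
      -3ℤ ℤ.* (1ℤ ℤ.+ + 3 ℤ.* + (2 ℕ.* M))
        ≡⟨ cong (-3ℤ ℤ.*_) (base≡1+3m (2 ℕ.* M)) ⟨
      -3ℤ ℤ.* + (1 ℕ.+ 3 ℕ.* (2 ℕ.* M)) ∎
      where module ℤS = ℤ-Solver.+-*-Solver

-- In the cross-multiplied form that `∣∣ₚ-size` expects, so that the size can be read off the
-- integer instead of the normalised fraction.
↥[z/1]*1≡z*↧[z/1] : ∀ z → ↥ fromℤ z ℤ.* 1ℤ ≡ z ℤ.* ↧ fromℤ z
↥[z/1]*1≡z*↧[z/1] z with fromℤ z | ℚ.toℚᵘ-fromℚᵘ (mkℚᵘ z 0)
... | record{} | *≡* e = e

-2-approximable-p : ∀ p pr → Approximable (PAdic.absoluteValue p pr) -2ℚ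
-2-approximable-p p pr ε 0<ε = fromℤ a , S⊆G (base (ℕ.pred q)) , (begin-strict
  ∣ -2ℚ - fromℤ a ∣ₚ          ≡⟨ cong ∣_∣ₚ difference ⟩
  ∣ fromℤ (-3ℤ ℤ.* + q) ∣ₚ    ≡⟨ ∣∣ₚ-size (fromℤ (-3ℤ ℤ.* + q)) (-3ℤ ℤ.* + q) 1 (↥[z/1]*1≡z*↧[z/1] (-3ℤ ℤ.* + q)) ⟩
  size ℤ.∣ -3ℤ ℤ.* + q ∣ 1    ≡⟨ cong (λ n → size n 1) (ℤ.abs-* -3ℤ (+ q)) ⟩
  -- Only a bound, because for p = 3 the factor 3 makes the size smaller still.
  size (3 ℕ.* q) 1            ≤⟨ size-≤ᴺ (3 ℕ.* q) (n∣m*n 3) ⟩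
  ratio 0 N                   <⟨ 1/m<ε q 0<ε (k<p^k N) ⟩
  ε                           ∎)
  where
  open PAdic p pr
  open ℚ.≤-Reasoning
  -- Since p^N exceeds `N`, its reciprocal is less than `ε`.
  N = ↧ₙ ε
  q = p ℕ.^ N
  instance
    q≢0 : ℕ.NonZero q
    q≢0 = ℕ.m^n≢0 p N {{prime⇒nonZero pr}}
  -- This is -2 + 3q, written as 1 + 3(q - 1) to show that it is positive and 1 modulo 3.
  a = + (1 ℕ.+ 3 ℕ.* ℕ.pred q)

  difference : -2ℚ - fromℤ a ≡ fromℤ (-3ℤ ℤ.* + q)
  difference = E.begin
    -2ℚ - fromℤ a
      E.≡⟨ ℚS.solve 1 (λ x → ℚS.con -2ℚ ℚS.:- x ℚS.:= ℚS.con -2ℚ ℚS.:+ ℚS.con (- 1ℚ) ℚS.:* x) refl (fromℤ a) ⟩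
    -2ℚ + - 1ℚ * fromℤ a
      E.≡⟨ cong (λ u → -2ℚ + u) (/1-* (ℤ.- 1ℤ) a) ⟨
    -2ℚ + fromℤ (ℤ.- 1ℤ ℤ.* a)
      E.≡⟨ /1-+ (ℤ.- (+ 2)) (ℤ.- 1ℤ ℤ.* a) ⟨
    fromℤ (ℤ.- (+ 2) ℤ.+ ℤ.- 1ℤ ℤ.* a)
      E.≡⟨ cong (λ u → fromℤ (ℤ.- (+ 2) ℤ.+ ℤ.- 1ℤ ℤ.* u)) (base≡1+3m (ℕ.pred q)) ⟩
    fromℤ (ℤ.- (+ 2) ℤ.+ ℤ.- 1ℤ ℤ.* (1ℤ ℤ.+ + 3 ℤ.* + ℕ.pred q))
      E.≡⟨ cong fromℤ (ℤS.solve 1 (λ k →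
             ℤS.con (ℤ.- (+ 2)) ℤS.:+ ℤS.con (ℤ.- 1ℤ) ℤS.:* (ℤS.con 1ℤ ℤS.:+ ℤS.con (+ 3) ℤS.:* k) ℤS.:=
             ℤS.con -3ℤ ℤS.:* (ℤS.con 1ℤ ℤS.:+ k)) refl (+ ℕ.pred q)) ⟩
    fromℤ (-3ℤ ℤ.* + suc (ℕ.pred q))
      E.≡⟨ cong (λ k → fromℤ (-3ℤ ℤ.* + k)) (ℕ.suc-pred q) ⟩
    fromℤ (-3ℤ ℤ.* + q) E.∎
    where
    module E = ≡-Reasoning
    module ℚS = ℚ-Solver.+-*-Solver
    module ℤS = ℤ-Solver.+-*-Solver

  ord-1 : ord p 1 ≡ 0
  ord-1 = ℕ.n<1⇒n≡0 (ℕ.<-≤-trans (k<p^k (ord p 1)) (∣⇒≤ (ord-∣ 1)))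

  size-≤ᴺ : ∀ n → q ∣ n → size n 1 ≤ ratio 0 N
  size-≤ᴺ zero        _   = ℚ.<⇒≤ (ratio-pos 0 N)
  size-≤ᴺ n@(suc _) q∣n = subst (λ i → ratio i (ord p n) ≤ ratio 0 N) (sym ord-1)
    (ratio-mono 0 (ord-max n N q∣n))

-2-approximable : ∀ v → Approximable (absoluteValue v) -2ℚ
-2-approximable (finite p pr) = -2-approximable-p p pr
-2-approximable ∞             = -2-approximable-∞

locallySolvable : ∀ v → SolvableInClosure G v 1ℤ 1ℤ 1ℤ
locallySolvable v =
  fromℚ 1ℚ , fromℚ 1ℚ , fromℚ -2ℚ , 1-closure , 1-closure
  , approximable⇒closure v {r = - ½} refl (-2-approximable v)
  -- All sequences are constant, so 1 + 1 - 2 = 0 holds termwise by computation, whatever the place.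
  , ≗⇒≈ {fromℚ 1ℚ ⊗ fromℚ 1ℚ ⊕ fromℚ 1ℚ ⊗ fromℚ 1ℚ ⊕ fromℚ 1ℚ ⊗ fromℚ -2ℚ} {fromℚ 0ℚ} (λ _ → refl)
  where
  open Completion (absoluteValue v)
  1-closure : Local.Closure v G (fromℚ 1ℚ)
  1-closure = approximable⇒closure v {r = 1ℚ} refl (∈G⇒approximable (absoluteValue v) (S⊆G S-1))

proposition9 : Σ[ G ∈ Subgroup ℚˣ-group 0ℓ ] FiniteIndex G ×
    (∃[ a ] ∃[ b ] ∃[ c ] a ≢ 0ℤ × b ≢ 0ℤ × c ≢ 0ℤ ×
    ¬ SolvableIn G a b c ×
    ((v : Place) → SolvableInClosure G v a b c))
proposition9 =
  G , G-finiteIndex , 1ℤ , 1ℤ , 1ℤ , (λ ()) , (λ ()) , (λ ()) , unsolvable , locallySolvable
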